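{- Let $G=(L\cup R,A)$ be a relevant directed graph, i.e. $G\in\mathcal{S}$. Then for each $K\in\{R,L\}$, $s^K_1(G)\geq s^K_2(G)$.
   Context: **Game.** A position is a finite directed graph $G=(L\cup R,A)$ whose vertex set $V(G)=L\cup R$ is partitioned into $L=L(G)$ and $R=R(G)$. For $S\subseteq V(G)$, $G\setminus S$ is the subgraph induced on $V(G)\setminus S$. $\mathrm{Succ}(G,x)$ (resp. $\mathrm{Pred}(G,x)$) is the set of vertices reachable from $x$ (resp. that can reach $x$) by a directed path, including $x$. Left and Right alternate; Left chooses $x\in L$ and removes $\mathrm{Succ}(G,x)$, Right chooses $y\in R$ and removes $\mathrm{Pred}(G,y)$; a player's score is the number of vertices he removed. **Relevant graphs.** $\mathrm{Forc}(G)=\{x\in L:\mathrm{Succ}(G,x)\subseteq L\}\cup\{y\in R:\mathrm{Pred}(G,y)\subseteq R\}$; $G$ is relevant if $\mathrm{Forc}(G)=\emptyset$, and $\mathcal{S}$ is the class of relevant graphs. On relevant graphs, forced vertices created by a move are immediately given to the player who moved: for $x\in L$, $\mathrm{Rmv}(G,x)=\mathrm{Succ}(G,x)\cup\mathrm{Forc}(G\setminus\mathrm{Succ}(G,x))$; for $y\in R$, $\mathrm{Rmv}(G,y)=\mathrm{Pred}(G,y)\cup\mathrm{Forc}(G\setminus\mathrm{Pred}(G,y))$; and $G_u=G\setminus\mathrm{Rmv}(G,u)$, again in $\mathcal{S}$. **Scores.** $s^L_1(G)$ (resp. $s^L_2(G)$) is Left's optimal score when Left (resp. Right) starts, and $s^R_1(G)$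 (resp. $s^R_2(G)$) is Right's optimal score when Right (resp. Left) starts. All are $0$ on the empty graph and, for nonempty $G\in\mathcal{S}$, $s^L_1(G)=\max_{x\in L}\{|\mathrm{Rmv}(G,x)|+s^L_2(G_x)\}$, $s^L_2(G)=\min_{y\in R}s^L_1(G_y)$, $s^R_1(G)=\max_{y\in R}\{|\mathrm{Rmv}(G,y)|+s^R_2(G_y)\}$, $s^R_2(G)=\min_{x\in L}s^R_1(G_x)$. -}

module Defs where

open import Data.Bool.Base using (Bool; T)
open import Data.Bool.Properties using (T?)
open import Data.Fin.Base using (Fin)
import Data.Fin.Properties as Fin
open import Data.Fin.Subset
  using (Subset; _∈_; _⊆_; _∪_; _─_; ∣_∣; Empty)
open import Data.Fin.Subset.Properties
  using (_∈?_; _⊆?_; p⊆p∪q; x∈p∩q⁺; p∩q≢∅⇒∣p─q∣<∣p∣)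
open import Data.List.Base using (List; []; _∷_; map; filter; foldr; allFin)
open import Data.List.Membership.Propositional using () renaming (_∈_ to _∈ˡ_)
open import Data.List.Membership.Propositional.Properties using (∈-allFin)
open import Data.List.Properties using (map-cong-local)
open import Data.List.Relation.Unary.All as All using (All; []; _∷_)
open import Data.List.Relation.Unary.All.Properties using (all-filter)
open import Data.List.Relation.Unary.Any using (here; there)
open import Data.Nat.Base using (ℕ; zero; suc; _+_; _≤_; _<_; _⊔_; _⊓_; _≤′_; ≤′-refl; ≤′-step)
open import Data.Nat.Properties using (≤-refl; ≤-pred; ≤-trans; <⇒≤; ≤⇒≤′; ≤′⇒≤; n≮0)
open import Data.Product.Base using (_×_; _,_)
open import Data.Sum.Base using (_⊎_; inj₁; inj₂)
open import Data.Vec.Base using (tabulate)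
open import Data.Vec.Properties
  using (lookup∘tabulate; lookup⇒[]=; []=⇒lookup)
open import Relation.Binary.Construct.Closure.ReflexiveTransitive
  using (Star; ε; _◅_; _◅◅_)
open import Relation.Binary.Core using (Rel)
import Relation.Binary.Definitions as B
open import Relation.Binary.PropositionalEquality
  using (_≡_; refl; sym; trans; cong)
open import Relation.Nullary
  using (does; yes; no; contradiction; _×-dec_; _⊎-dec_)
open import Relation.Nullary.Decidable using (map′; dec-true)
open import Relation.Unary using (Decidable)
open import Level using (0ℓ)

private
  variable
    n : ℕ

-- Decidability of reachability, by the Floyd–Warshall recursion:
-- `Via R? vs x y` holds when there is a walk from x to y all of whose
-- intermediate vertices lie in vs.

module _ {R : Rel (Fin n) 0ℓ} (R? : B.Decidable R) where

  Via : List (Fin n) → Rel (Fin n) 0ℓ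
  Via []       x y = x ≡ y ⊎ R x y
  Via (v ∷ vs) x y = Via vs x y ⊎ (Via vs x v × Via vs v y)

  via? : ∀ vs → B.Decidable (Via vs)
  via? []       x y = (x Fin.≟ y) ⊎-dec R? x y
  via? (v ∷ vs) x y = via? vs x y ⊎-dec (via? vs x v ×-dec via? vs v y)

  via⇒star : ∀ vs {x y} → Via vs x y → Star R x y
  via⇒star []       (inj₁ refl)    = ε
  via⇒star []       (inj₂ r)       = r ◅ ε
  via⇒star (_ ∷ vs) (inj₁ p)       = via⇒star vs p
  via⇒star (_ ∷ vs) (inj₂ (p , q)) = via⇒star vs p ◅◅ via⇒star vs q

  via-base : ∀ vs {x y} → x ≡ y ⊎ R x y → Via vs x y
  via-base []       p = p
  via-base (_ ∷ vs) p = inj₁ (via-base vs p)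

  via-join : ∀ {vs x y z} → z ∈ˡ vs → Via vs x z → Via vs z y → Via vs x y
  via-join (here refl) p q = inj₂ (before p , after q)
    where
    before : ∀ {v vs x} → Via (v ∷ vs) x v → Via vs x v
    before (inj₁ p)       = p
    before (inj₂ (p , _)) = p
    after : ∀ {v vs y} → Via (v ∷ vs) v y → Via vs v y
    after (inj₁ p)       = p
    after (inj₂ (_ , p)) = p
  via-join (there z∈) (inj₁ p)       (inj₁ q)       = inj₁ (via-join z∈ p q)
  via-join (there z∈) (inj₁ p)       (inj₂ (q , s)) = inj₂ (via-join z∈ p q , s)
  via-join (there z∈) (inj₂ (p , q)) (inj₁ s)       = inj₂ (p , via-join z∈ q s)
  via-join (there z∈) (inj₂ (p , _)) (inj₂ (_ , s)) = inj₂ (p , s)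

  star⇒via : ∀ {x y} → Star R x y → Via (allFin n) x y
  star⇒via ε               = via-base (allFin n) (inj₁ refl)
  star⇒via (_◅_ {j = z} r s) =
    via-join (∈-allFin z) (via-base (allFin n) (inj₂ r)) (star⇒via s)

  star? : B.Decidable (Star R)
  star? x y = map′ (via⇒star (allFin n)) star⇒via (via? (allFin n) x y)

comprehension : {P : Fin n → Set} → Decidable P → Subset n
comprehension P? = tabulate (λ x → does (P? x))

∈-comprehension⁺ : {P : Fin n → Set} (P? : Decidable P) →
                   ∀ {x} → P x → x ∈ comprehension P?
∈-comprehension⁺ P? {x} px =
  lookup⇒[]= x _ (trans (lookup∘tabulate _ x) (dec-true (P? x) px))

∈-comprehension⁻ : {P : Fin n → Set} (P? : Decidable P) →
                   ∀ {x} → x ∈ comprehension P? → P x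
∈-comprehension⁻ P? {x} x∈
  with P? x | trans (sym (lookup∘tabulate (λ y → does (P? y)) x)) ([]=⇒lookup x∈)
... | yes px | _  = px
... | no  _  | ()

data Player : Set where
  left right : Player

opponent : Player → Player
opponent left  = right
opponent right = left

_≟ᴾ_ : B.DecidableEquality Player
left  ≟ᴾ left  = yes refl
left  ≟ᴾ right = no λ ()
right ≟ᴾ left  = no λ ()
right ≟ᴾ right = yes refl

-- The vertices of a graph are a subset V of an ambient Fin n, so that
-- induced subgraphs keep their vertex names. The values of owner and arc
-- outside V are irrelevant (see Arc).

record Graph (n : ℕ) : Set where
  field
    V     : Subset n
    owner : Fin n → Player
    arc   : Fin n → Fin n → Bool

open Graph public

infixl 5 _∖_

_∖_ : Graph n → Subset n → Graph n
G ∖ S = record G { V = V G ─ S }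

module _ (G : Graph n) where

  Owned : Player → Fin n → Set
  Owned K x = x ∈ V G × owner G x ≡ K

  owned? : ∀ K → Decidable (Owned K)
  owned? K x = (x ∈? V G) ×-dec (owner G x ≟ᴾ K)

  -- L(G) and R(G) are side left and side right.
  side : Player → Subset n
  side K = comprehension (owned? K)

  Arc : Rel (Fin n) 0ℓ
  Arc x y = x ∈ V G × y ∈ V G × T (arc G x y)

  arc? : B.Decidable Arc
  arc? x y = (x ∈? V G) ×-dec ((y ∈? V G) ×-dec T? (arc G x y))

  Reach : Rel (Fin n) 0ℓ
  Reach = Star Arc

  reach? : B.Decidable Reach
  reach? = star? arc?

  Succ : Fin n → Subset n
  Succ x = comprehension (λ y → (y ∈? V G) ×-dec reach? x y)

  Pred : Fin n → Subset n
  Pred y = comprehension (λ x → (x ∈? V G) ×-dec reach? x y)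

  Forced : Fin n → Set
  Forced x = (x ∈ side left  × Succ  x ⊆ side left)
           ⊎ (x ∈ side right × Pred x ⊆ side right)

  forced? : Decidable Forced
  forced? x = ((x ∈? side left)  ×-dec (Succ  x ⊆? side left))
        ⊎-dec ((x ∈? side right) ×-dec (Pred x ⊆? side right))

  Forc : Subset n
  Forc = comprehension forced?

  Relevant : Set
  Relevant = Empty Forc

  -- What the owner of u removes when playing u, before forced vertices.
  cut : Fin n → Subset n
  cut u with owner G u
  ... | left  = Succ u
  ... | right = Pred u

Rmv : Graph n → Fin n → Subset n
Rmv G u = cut G u ∪ Forc (G ∖ cut G u)

-- G_u
infixl 5 _after_

_after_ : Graph n → Fin n → Graph n
G after u = G ∖ Rmv G u

moves : Graph n → Player → List (Fin n)
moves G K = filter (owned? G K) (allFin _)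

-- Both are 0 on the empty list. A nonempty relevant graph has vertices of
-- both owners, so there the lists below are nonempty; on the empty graph
-- the value 0 is the intended score.

maximum : List ℕ → ℕ
maximum = foldr _⊔_ 0

minimum : List ℕ → ℕ
minimum []       = 0
minimum (x ∷ xs) = foldr _⊓_ x xs

-- Scores of K when K, respectively K's opponent, starts, with play cut off
-- after k moves. Each move removes its own vertex, so cutting off after
-- ∣ V G ∣ moves loses nothing: see s₁-recurrence and s₂-recurrence.

score₁ score₂ : ℕ → Player → Graph n → ℕ
score₁ zero    K G = 0
score₁ (suc k) K G =
  maximum (map (λ u → ∣ Rmv G u ∣ + score₂ k K (G after u)) (moves G K))
score₂ zero    K G = 0
score₂ (suc k) K G =
  minimum (map (λ u → score₁ k K (G after u)) (moves G (opponent K)))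

s₁ s₂ : Player → Graph n → ℕ
s₁ K G = score₁ ∣ V G ∣ K G
s₂ K G = score₂ ∣ V G ∣ K G

∈-cut : (G : Graph n) → ∀ {u} → u ∈ V G → u ∈ cut G u
∈-cut G {u} u∈ with owner G u
... | left  = ∈-comprehension⁺ (λ y → (y ∈? V G) ×-dec reach? G u y) (u∈ , ε)
... | right = ∈-comprehension⁺ (λ x → (x ∈? V G) ×-dec reach? G x u) (u∈ , ε)

after-< : (G : Graph n) → ∀ {u} → u ∈ V G → ∣ V (G after u) ∣ < ∣ V G ∣
after-< G {u} u∈ = p∩q≢∅⇒∣p─q∣<∣p∣ (V G) (Rmv G u)
  (u , x∈p∩q⁺ (u∈ , p⊆p∪q (Forc (G ∖ cut G u)) (∈-cut G u∈)))

all-moves : (G : Graph n) (K : Player) → All (Owned G K) (moves G K)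
all-moves G K = all-filter (owned? G K) (allFin _)

no-moves : (G : Graph n) (K : Player) → ∣ V G ∣ ≤ 0 → moves G K ≡ []
no-moves G K G≤0 with moves G K | all-moves G K
... | []    | _               = refl
... | _ ∷ _ | (u∈ , _) ∷ _ = contradiction (≤-trans (after-< G u∈) G≤0) n≮0

score₁-stable : ∀ k K (G : Graph n) → ∣ V G ∣ ≤ k →
                score₁ (suc k) K G ≡ score₁ k K G
score₂-stable : ∀ k K (G : Graph n) → ∣ V G ∣ ≤ k →
                score₂ (suc k) K G ≡ score₂ k K G
score₁-stable zero    K G G≤k rewrite no-moves G K G≤k = refl
score₁-stable (suc k) K G G≤k = cong maximum (map-cong-local (All.map
  (λ {u} (u∈ , _) → cong (∣ Rmv G u ∣ +_)
    (score₂-stable k K (G after u) (≤-pred (≤-trans (after-< G u∈) G≤k))))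
  (all-moves G K)))
score₂-stable zero    K G G≤k rewrite no-moves G (opponent K) G≤k = refl
score₂-stable (suc k) K G G≤k = cong minimum (map-cong-local (All.map
  (λ {u} (u∈ , _) →
    score₁-stable k K (G after u) (≤-pred (≤-trans (after-< G u∈) G≤k)))
  (all-moves G (opponent K))))

score₁-enough : ∀ k K (G : Graph n) → ∣ V G ∣ ≤ k → score₁ k K G ≡ s₁ K G
score₂-enough : ∀ k K (G : Graph n) → ∣ V G ∣ ≤ k → score₂ k K G ≡ s₂ K G
score₁-enough k K G G≤k = go (≤⇒≤′ G≤k)
  where
  go : ∀ {k} → ∣ V G ∣ ≤′ k → score₁ k K G ≡ s₁ K G
  go ≤′-refl     = refl
  go (≤′-step p) = trans (score₁-stable _ K G (≤′⇒≤ p)) (go p)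
score₂-enough k K G G≤k = go (≤⇒≤′ G≤k)
  where
  go : ∀ {k} → ∣ V G ∣ ≤′ k → score₂ k K G ≡ s₂ K G
  go ≤′-refl     = refl
  go (≤′-step p) = trans (score₂-stable _ K G (≤′⇒≤ p)) (go p)

s₁-recurrence : ∀ K (G : Graph n) → s₁ K G ≡
  maximum (map (λ u → ∣ Rmv G u ∣ + s₂ K (G after u)) (moves G K))
s₁-recurrence K G = trans (sym (score₁-stable _ K G ≤-refl))
  (cong maximum (map-cong-local (All.map
    (λ {u} (u∈ , _) → cong (∣ Rmv G u ∣ +_)
      (score₂-enough _ K (G after u) (<⇒≤ (after-< G u∈))))
    (all-moves G K))))

s₂-recurrence : ∀ K (G : Graph n) → s₂ K G ≡
  minimum (map (λ u → s₁ K (G after u)) (moves G (opponent K)))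
s₂-recurrence K G = trans (sym (score₂-stable _ K G ≤-refl))
  (cong minimum (map-cong-local (All.map
    (λ {u} (u∈ , _) →
      score₁-enough _ K (G after u) (<⇒≤ (after-< G u∈)))
    (all-moves G (opponent K)))))

{-# OPTIONS --safe #-}
module Submission where

open import Algebra.Properties.CommutativeSemigroup using (x∙yz≈y∙xz)
open import Data.Fin.Base using (Fin)
open import Data.Fin.Subset
  using (Subset; inside; outside; _∈_; _∉_; _⊆_; _─_; ∣_∣; Empty)
open import Data.Fin.Subset.Properties
  using (_∈?_; p─q─r≡p─q∪r; x∈p∧x∉q⇒x∈p─q; p─q⊆p; x∈p∪q⁻; x∈p∪q⁺;
         drop-∷-⊆; p⊆q⇒∣p∣≤∣q∣; Empty-unique; ∣⊥∣≡0)
open import Data.List.Base using ([]; _∷_; map; allFin)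
open import Data.List.Membership.Propositional using () renaming (_∈_ to _∈ˡ_)
open import Data.List.Membership.Propositional.Properties
  using (∈-allFin; ∈-filter⁺; ∈-filter⁻; ∈-map⁺; ∈-map⁻; foldr-selective)
open import Data.List.Properties using (foldr-preservesᵒ)
open import Data.List.Relation.Unary.Any as Any using (here; there)
open import Data.Nat.Base using (ℕ; suc; _+_; _≤_; _≥_; _<_; z≤n; s≤s⁻¹)
open import Data.Nat.Properties
open import Data.Product.Base using (∃; _×_; _,_; proj₁; proj₂)
open import Data.Sum.Base as Sum using (_⊎_; inj₁; inj₂; [_,_]′)
open import Data.Vec.Base using ([]; _∷_; here; there)
open import Function.Base using (_∘_; id; case_of_)
open import Level using (0ℓ)
open import Relation.Binary.Construct.Closure.ReflexiveTransitive as Star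
  using (Star; ε; _◅_; _◅◅_)
open import Relation.Binary.Core using (Rel)
open import Relation.Binary.PropositionalEquality
  using (_≡_; refl; sym; trans; cong; subst)
open import Relation.Nullary using (¬_; yes; no; contradiction; _×-dec_)
open import Defs

-- Giving the opponent of J a free set of vertices never helps J: if W is closed
-- under the direction in which J removes, and G and G[W] are relevant, then J
-- scores at most as much on G[W] as on G. Playing on G, J copies the moves of
-- G[W]. An opponent's move inside W can be copied in G[W], because G after u is
-- the largest relevant closed subgraph avoiding u. After an opponent's move
-- outside W, the board still contains G[W], with J to move there; this is no
-- loss by the corollary itself for the smaller graph G[W]. Conversely, since the
-- two scores add up to ∣ V G ∣, moving first at u yields the corollary for G:
-- passing from G to G after u can only lower the other player's score.

private
  variable
    n : ℕ
    A : Set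

-- Finite subsets and extrema of lists.

∈─⇒∉ : ∀ {p q : Subset n} {x} → x ∈ p ─ q → x ∉ q
∈─⇒∉ {p = inside ∷ _} {q = outside ∷ _} here ()
∈─⇒∉ {p = _ ∷ _} {q = _ ∷ _} (there x∈) (there x∈q) = ∈─⇒∉ x∈ x∈q

∣q∣+∣p─q∣≡∣p∣ : ∀ {p q : Subset n} → q ⊆ p → ∣ q ∣ + ∣ p ─ q ∣ ≡ ∣ p ∣
∣q∣+∣p─q∣≡∣p∣ {p = []}          {[]}          _   = refl
∣q∣+∣p─q∣≡∣p∣ {p = inside  ∷ p} {inside  ∷ q} q⊆p = cong suc (∣q∣+∣p─q∣≡∣p∣ (drop-∷-⊆ q⊆p))
∣q∣+∣p─q∣≡∣p∣ {p = inside  ∷ p} {outside ∷ q} q⊆p =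
  trans (+-suc ∣ q ∣ _) (cong suc (∣q∣+∣p─q∣≡∣p∣ (drop-∷-⊆ q⊆p)))
∣q∣+∣p─q∣≡∣p∣ {p = outside ∷ p} {inside  ∷ q} q⊆p with () ← q⊆p here
∣q∣+∣p─q∣≡∣p∣ {p = outside ∷ p} {outside ∷ q} q⊆p = ∣q∣+∣p─q∣≡∣p∣ (drop-∷-⊆ q⊆p)

≤-maximum : ∀ (f : A → ℕ) {x xs} → x ∈ˡ xs → f x ≤ maximum (map f xs)
≤-maximum f {x} {xs} x∈ = foldr-preservesᵒ {P = f x ≤_}
  (λ a b → [ m≤n⇒m≤n⊔o b , m≤n⇒m≤o⊔n a ]′) 0 _
  (inj₂ (Any.map ≤-reflexive (∈-map⁺ f x∈)))

minimum-≤ : ∀ (f : A → ℕ) {x xs} → x ∈ˡ xs → minimum (map f xs) ≤ f x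
minimum-≤ f {x} {y ∷ xs} x∈ = foldr-preservesᵒ {P = _≤ f x}
  (λ a b → [ m≤n⇒m⊓o≤n b , m≤n⇒o⊓m≤n a ]′) (f y) _
  (case x∈ of λ where
    (here refl)  → inj₁ ≤-refl
    (there x∈xs) → inj₂ (Any.map (≤-reflexive ∘ sym) (∈-map⁺ f x∈xs)))

maximum-attained : ∀ (f : A → ℕ) xs →
  xs ≡ [] × maximum (map f xs) ≡ 0 ⊎ ∃ λ x → x ∈ˡ xs × maximum (map f xs) ≡ f x
maximum-attained f []           = inj₁ (refl , refl)
maximum-attained f (x ∷ xs) with foldr-selective ⊔-sel 0 (map f (x ∷ xs))
-- If the fold returns its default value 0 on a nonempty list, then every value is 0, so the head
-- attains the maximum.
... | inj₁ max≡0 = inj₂ (x , here refl , ≤-antisym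
  (subst (_≤ f x) (sym max≡0) z≤n) (≤-maximum f {xs = x ∷ xs} (here refl)))
... | inj₂ max∈  = inj₂ (∈-map⁻ f max∈)

minimum-attained : ∀ (f : A → ℕ) xs →
  xs ≡ [] × minimum (map f xs) ≡ 0 ⊎ ∃ λ x → x ∈ˡ xs × minimum (map f xs) ≡ f x
minimum-attained f []       = inj₁ (refl , refl)
minimum-attained f (x ∷ xs) with foldr-selective ⊓-sel (f x) (map f xs)
... | inj₁ min≡  = inj₂ (x , here refl , min≡)
... | inj₂ min∈ with y , y∈ , eq ← ∈-map⁻ f min∈ = inj₂ (y , there y∈ , eq)

-- Bounds on the scores and optimal moves.

∈-moves : ∀ (G : Graph n) {K u} → Owned G K u → u ∈ˡ moves G K
∈-moves G {K} o = ∈-filter⁺ (owned? G K) (∈-allFin _) o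

∈-moves⁻ : ∀ (G : Graph n) {K u} → u ∈ˡ moves G K → Owned G K u
∈-moves⁻ G {K} u∈ = proj₂ (∈-filter⁻ (owned? G K) {xs = allFin _} u∈)

¬owned : ∀ (G : Graph n) {K} → moves G K ≡ [] → ∀ {u} → ¬ Owned G K u
¬owned G {K} eq {u} o with () ← subst (u ∈ˡ_) eq (∈-moves G o)

module _ (G : Graph n) where

  s₁-≥ : ∀ {K u} → Owned G K u → ∣ Rmv G u ∣ + s₂ K (G after u) ≤ s₁ K G
  s₁-≥ {K} o = ≤-trans
    (≤-maximum (λ u → ∣ Rmv G u ∣ + s₂ K (G after u)) (∈-moves G o))
    (≤-reflexive (sym (s₁-recurrence K G)))

  s₂-≤ : ∀ {K u} → Owned G (opponent K) u → s₂ K G ≤ s₁ K (G after u)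
  s₂-≤ {K} o = ≤-trans (≤-reflexive (s₂-recurrence K G))
    (minimum-≤ (λ u → s₁ K (G after u)) (∈-moves G o))

  s₁-attained : ∀ K →
    ((∀ {u} → ¬ Owned G K u) × s₁ K G ≡ 0)
    ⊎ ∃ λ u → Owned G K u × s₁ K G ≡ ∣ Rmv G u ∣ + s₂ K (G after u)
  s₁-attained K rewrite s₁-recurrence K G
    with maximum-attained (λ u → ∣ Rmv G u ∣ + s₂ K (G after u)) (moves G K)
  ... | inj₁ (none , eq)    = inj₁ (¬owned G none , eq)
  ... | inj₂ (u , u∈ , eq) = inj₂ (u , ∈-moves⁻ G u∈ , eq)

  s₂-attained : ∀ K →
    ((∀ {u} → ¬ Owned G (opponent K) u) × s₂ K G ≡ 0)
    ⊎ ∃ λ u → Owned G (opponent K) u × s₂ K G ≡ s₁ K (G after u)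
  s₂-attained K rewrite s₂-recurrence K G
    with minimum-attained (λ u → s₁ K (G after u)) (moves G (opponent K))
  ... | inj₁ (none , eq)    = inj₁ (¬owned G none , eq)
  ... | inj₂ (u , u∈ , eq) = inj₂ (u , ∈-moves⁻ G u∈ , eq)

-- Reachability, cuts and forced vertices, relative to a player.

opponent-involutive : ∀ K → opponent (opponent K) ≡ K
opponent-involutive left  = refl
opponent-involutive right = refl

own-or-opponent : ∀ J K → K ≡ J ⊎ K ≡ opponent J
own-or-opponent left  left  = inj₁ refl
own-or-opponent left  right = inj₂ refl
own-or-opponent right left  = inj₂ refl
own-or-opponent right right = inj₁ refl

-- Step G K and Toward G K follow the arcs in the direction in which K removes
-- vertices, so that a statement about K also covers the opponent.

module _ (G : Graph n) where

  Step : Player → Rel (Fin n) 0ℓ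
  Step left  x y = Arc G x y
  Step right x y = Arc G y x

  Toward : Player → Rel (Fin n) 0ℓ
  Toward K = Star (Step K)

  step-flip : ∀ K {x y} → Step K x y → Step (opponent K) y x
  step-flip left  a = a
  step-flip right a = a

  toward-flip : ∀ K {x y} → Toward K x y → Toward (opponent K) y x
  toward-flip K = Star.reverse (step-flip K)

  step-target : ∀ K {x y} → Step K x y → y ∈ V G
  step-target left  (_ , y∈ , _) = y∈
  step-target right (y∈ , _)     = y∈

  toward-target : ∀ K {x y} → x ∈ V G → Toward K x y → y ∈ V G
  toward-target K x∈ ε       = x∈
  toward-target K x∈ (a ◅ p) = toward-target K (step-target K a) p

  -- The clause of `Forced` that belongs to `K`, with paths in place of `Succ` and `Pred`, so that
  -- both clauses take one form.
  ForcedFor : Player → Fin n → Set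
  ForcedFor K x = x ∈ V G × (∀ {y} → Toward K x y → owner G y ≡ K)

  Forc⁺ : ∀ K {x} → ForcedFor K x → x ∈ Forc G
  Forc⁺ left (x∈ , own) = ∈-comprehension⁺ (forced? G) (inj₁
    ( ∈-comprehension⁺ (owned? G left) (x∈ , own ε)
    , λ y∈ → case ∈-comprehension⁻ (λ y → (y ∈? V G) ×-dec reach? G _ y) y∈ of λ where
        (y∈V , p) → ∈-comprehension⁺ (owned? G left) (y∈V , own p)))
  Forc⁺ right (x∈ , own) = ∈-comprehension⁺ (forced? G) (inj₂
    ( ∈-comprehension⁺ (owned? G right) (x∈ , own ε)
    , λ y∈ → case ∈-comprehension⁻ (λ y → (y ∈? V G) ×-dec reach? G y _) y∈ of λ where
        (y∈V , p) → ∈-comprehension⁺ (owned? G right) (y∈V , own (toward-flip left p))))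

  Forc⁻ : ∀ {x} → x ∈ Forc G → ∃ λ K → ForcedFor K x
  Forc⁻ x∈ with ∈-comprehension⁻ (forced? G) x∈
  ... | inj₁ (x∈L , succ⊆) = left , x∈V , λ p → proj₂ (∈-comprehension⁻ (owned? G left)
    (succ⊆ (∈-comprehension⁺ (λ y → (y ∈? V G) ×-dec reach? G _ y)
      (toward-target left x∈V p , p))))
    where x∈V = proj₁ (∈-comprehension⁻ (owned? G left) x∈L)
  ... | inj₂ (x∈R , pred⊆) = right , x∈V , λ p → proj₂ (∈-comprehension⁻ (owned? G right)
    (pred⊆ (∈-comprehension⁺ (λ y → (y ∈? V G) ×-dec reach? G y _)
      (toward-target right x∈V p , toward-flip right p))))
    where x∈V = proj₁ (∈-comprehension⁻ (owned? G right) x∈R)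

  cut⁺ : ∀ K {u y} → owner G u ≡ K → y ∈ V G → Toward K u y → y ∈ cut G u
  cut⁺ left  {u} eq y∈ p with owner G u
  cut⁺ left  {u} refl y∈ p | .left  =
    ∈-comprehension⁺ (λ y → (y ∈? V G) ×-dec reach? G u y) (y∈ , p)
  cut⁺ right {u} eq y∈ p with owner G u
  cut⁺ right {u} refl y∈ p | .right =
    ∈-comprehension⁺ (λ y → (y ∈? V G) ×-dec reach? G y u) (y∈ , toward-flip right p)

  cut⁻ : ∀ K {u y} → owner G u ≡ K → y ∈ cut G u → y ∈ V G × Toward K u y
  cut⁻ left  {u} eq y∈ with owner G u
  cut⁻ left  {u} refl y∈ | .left =
    ∈-comprehension⁻ (λ y → (y ∈? V G) ×-dec reach? G u y) y∈
  cut⁻ right {u} eq y∈ with owner G u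
  cut⁻ right {u} refl y∈ | .right
    with y∈V , p ← ∈-comprehension⁻ (λ y → (y ∈? V G) ×-dec reach? G y u) y∈
    = y∈V , toward-flip left p

relevant-intro : (G : Graph n) (J : Player) →
  (∀ {x} → ¬ ForcedFor G J x) → (∀ {x} → ¬ ForcedFor G (opponent J) x) → Relevant G
relevant-intro G J ¬own ¬opp (x , x∈) with K , f ← Forc⁻ G x∈ | own-or-opponent J K
... | inj₁ refl = ¬own f
... | inj₂ refl = ¬opp f

relevant-elim : (G : Graph n) → Relevant G → ∀ K {x} → ¬ ForcedFor G K x
relevant-elim G rel K f = rel (_ , Forc⁺ G K f)

Forc-opponent : (G : Graph n) (J : Player) → (∀ {x} → ¬ ForcedFor G J x) →
                ∀ {x} → x ∈ Forc G → ForcedFor G (opponent J) x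
Forc-opponent G J ¬own x∈ with K , f ← Forc⁻ G x∈ | own-or-opponent J K
... | inj₁ refl = contradiction f ¬own
... | inj₂ refl = f

-- Induced subgraphs and closed sets.

infixl 5 _↾_

-- `G ∖ S` is definitionally `G ↾ (V G ─ S)`, so facts about `↾` apply directly to `∖` and `after`.
_↾_ : Graph n → Subset n → Graph n
G ↾ W = record G { V = W }

module _ (G : Graph n) {W : Subset n} where

  step-↾⁺ : ∀ K {x y} → x ∈ W → y ∈ W → Step G K x y → Step (G ↾ W) K x y
  step-↾⁺ left  x∈ y∈ (_ , _ , a) = x∈ , y∈ , a
  step-↾⁺ right x∈ y∈ (_ , _ , a) = y∈ , x∈ , a

  module _ (W⊆V : W ⊆ V G) where

    step-↾⁻ : ∀ K {x y} → Step (G ↾ W) K x y → Step G K x y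
    step-↾⁻ left  (x∈ , y∈ , a) = W⊆V x∈ , W⊆V y∈ , a
    step-↾⁻ right (x∈ , y∈ , a) = W⊆V x∈ , W⊆V y∈ , a

    toward-↾⁻ : ∀ K {x y} → Toward (G ↾ W) K x y → Toward G K x y
    toward-↾⁻ K = Star.map (step-↾⁻ K)

    forced-↾⁺ : ∀ K {x} → x ∈ W → ForcedFor G K x → ForcedFor (G ↾ W) K x
    forced-↾⁺ K x∈ (_ , own) = x∈ , λ p → own (toward-↾⁻ K p)

-- The vertex sets that can remain of G after removals by the opponent of J.

record Closed (J : Player) (G : Graph n) (W : Subset n) : Set where
  constructor closed
  field
    included : W ⊆ V G
    stays    : ∀ {x y} → Step G J x y → x ∈ W → y ∈ W

open Closed

module _ {J : Player} (G : Graph n) {W : Subset n} (c : Closed J G W) where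

  toward-↾⁺ : ∀ {x y} → x ∈ W → Toward G J x y → y ∈ W × Toward (G ↾ W) J x y
  toward-↾⁺ x∈ ε       = x∈ , ε
  toward-↾⁺ x∈ (a ◅ p) with z∈ ← stays c a x∈ | y∈ , q ← toward-↾⁺ (stays c a x∈) p =
    y∈ , step-↾⁺ G J x∈ z∈ a ◅ q

  -- Paths in the direction of `J` never leave a closed set, so restricting to it creates no new
  -- vertex forced for `J`.
  forced-↾⁻ : ∀ {x} → ForcedFor (G ↾ W) J x → ForcedFor G J x
  forced-↾⁻ (x∈ , own) = included c x∈ , λ p → own (proj₂ (toward-↾⁺ x∈ p))

  closed-trans : ∀ {U} → Closed J (G ↾ W) U → Closed J G U
  closed-trans d = closed (included c ∘ included d) λ a x∈ →
    stays d (step-↾⁺ G J (included d x∈) (stays c a (included d x∈)) a) x∈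

  closed-between : ∀ {U} → W ⊆ U → U ⊆ V G → Closed J (G ↾ U) W
  closed-between W⊆U U⊆V = closed W⊆U λ a x∈ → stays c (step-↾⁻ G U⊆V J a) x∈

-- The board left by a move.

cut-closed : ∀ {J} (G : Graph n) {u} → owner G u ≡ opponent J →
             Closed J G (V G ─ cut G u)
cut-closed {J = J} G {u} own = closed (p─q⊆p _ _) λ {x} {y} a x∈ →
  -- If the step from `x` entered the cut at `y`, its reversal would prolong the path from `u` to
  -- `y` up to `x`, and `x` would have been cut.
  x∈p∧x∉q⇒x∈p─q (step-target G J a) λ y∈ → ∈─⇒∉ x∈
    (cut⁺ G (opponent J) own (p─q⊆p _ _ x∈)
      (proj₂ (cut⁻ G (opponent J) own y∈) ◅◅ (step-flip G J a ◅ ε)))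

∖Forc-closed : ∀ {J} (G : Graph n) → (∀ {x} → ¬ ForcedFor G J x) →
               Closed J G (V G ─ Forc G)
∖Forc-closed {J = J} G ¬own = closed (p─q⊆p _ _) λ {x} {y} a x∈ →
  x∈p∧x∉q⇒x∈p─q (step-target G J a) λ y∈ → ∈─⇒∉ x∈
    (Forc⁺ G (opponent J) (p─q⊆p _ _ x∈ , λ p →
      proj₂ (Forc-opponent G J ¬own y∈) (step-flip G J a ◅ p)))

-- One round of deleting forced vertices suffices. Let `x` be forced for the opponent `K` after the
-- deletion. A path of `K` from `x` in `G` meets vertices of `K` until it enters `Forc G`, and only
-- vertices of `K` from there on; so `x` was already forced in `G`. For `J`, closedness creates no
-- forced vertex.
∖Forc-relevant : ∀ {J} (G : Graph n) → (∀ {x} → ¬ ForcedFor G J x) →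
                 Relevant (G ∖ Forc G)
∖Forc-relevant {J = J} G ¬own = relevant-intro (G ∖ Forc G) J
  (¬own ∘ forced-↾⁻ G (∖Forc-closed G ¬own))
  (λ f → ∈─⇒∉ (proj₁ f) (Forc⁺ G (opponent J) (p─q⊆p _ _ (proj₁ f) , owned f)))
  where
  K = opponent J
  owned : ∀ {x y} → ForcedFor (G ∖ Forc G) K x → Toward G K x y → owner G y ≡ K
  owned f ε = proj₂ f ε
  owned f (_◅_ {j = z} a p) with z ∈? Forc G
  ... | yes z∈ = proj₂ (Forc-opponent G J ¬own z∈) p
  ... | no  z∉ with z∈′ ← x∈p∧x∉q⇒x∈p─q (step-target G K a) z∉ =
    owned (z∈′ , λ q → proj₂ f (step-↾⁺ G K (proj₁ f) z∈′ a ◅ q)) p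

module _ {J : Player} (G : Graph n) (rel : Relevant G)
         {u : Fin n} (own : owner G u ≡ opponent J) where

  private
    G′ = G ∖ cut G u

    ¬forced : ∀ {x} → ¬ ForcedFor G′ J x
    ¬forced = relevant-elim G rel J ∘ forced-↾⁻ G (cut-closed G own)

    -- Splits `after` into two deletions, first the cut and then the forced vertices, each leaving a
    -- closed set.
    V-after : V G′ ─ Forc G′ ≡ V (G after u)
    V-after = p─q─r≡p─q∪r (V G) (cut G u) (Forc G′)

  after-closed : Closed J G (V (G after u))
  after-closed = subst (Closed J G) V-after
    (closed-trans G (cut-closed G own) (∖Forc-closed G′ ¬forced))

  after-relevant : Relevant (G after u)
  after-relevant = subst (Relevant ∘ (G ↾_)) V-after (∖Forc-relevant G′ ¬forced)

  Forc-cut : ∀ {x} → x ∈ Forc G′ → ForcedFor G′ (opponent J) x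
  Forc-cut = Forc-opponent G′ J ¬forced

  -- A vertex of `W` in the cut would reach `u` in the direction of `J`, which forces `u ∈ W`. A
  -- vertex of `W` in `Forc G′` would stay forced in the smaller graph `G ↾ W`, against its
  -- relevance.
  after-largest : ∀ {W} → Closed J G W → Relevant (G ↾ W) → u ∉ W →
                  W ⊆ V (G after u)
  after-largest {W} c relW u∉ x∈ = subst (_ ∈_) V-after
    (x∈p∧x∉q⇒x∈p─q (W⊆V′ x∈) λ x∈F → relevant-elim (G ↾ W) relW (opponent J)
      (forced-↾⁺ G′ W⊆V′ (opponent J) x∈ (Forc-cut x∈F)))
    where
    W⊆V′ : W ⊆ V G′
    W⊆V′ x∈ = x∈p∧x∉q⇒x∈p─q (included c x∈) λ x∈cut → u∉ (proj₁ (toward-↾⁺ G c x∈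
      (subst (λ K → Toward G K _ u) (opponent-involutive J)
        (toward-flip G (opponent J) (proj₂ (cut⁻ G (opponent J) own x∈cut))))))

∣Rmv∣+∣after∣≡∣V∣ : (G : Graph n) (u : Fin n) → ∣ Rmv G u ∣ + ∣ V (G after u) ∣ ≡ ∣ V G ∣
∣Rmv∣+∣after∣≡∣V∣ G u = ∣q∣+∣p─q∣≡∣p∣ λ z∈ → case x∈p∪q⁻ (cut G u) _ z∈ of λ where
  (inj₁ z∈cut)  → proj₁ (cut⁻ G (owner G u) refl z∈cut)
  (inj₂ z∈Forc) → p─q⊆p _ _ (proj₁ (proj₂ (Forc⁻ (G ∖ cut G u) z∈Forc)))

-- Lets the facts above on moves of the opponent of `J` be applied to moves of `K` itself, with `J`
-- taken as `opponent K`.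
owned-involutive : (G : Graph n) → ∀ {K u} → Owned G K u → Owned G (opponent (opponent K)) u
owned-involutive G {K} (u∈ , own) = u∈ , trans own (sym (opponent-involutive K))

-- Comparing a move on a graph with the same move on a closed subgraph.

module _ {J : Player} (G : Graph n) {W : Subset n} (c : Closed J G W)
         (rel : Relevant G) (relW : Relevant (G ↾ W)) where

  private
    H = G ↾ W

  -- `V (H after u)` is closed in `G`, induces a relevant graph and avoids `u`, so `after-largest`
  -- places it inside `G after u`.
  opponent-move-in : ∀ {u} → Owned H (opponent J) u →
                     Closed J (G after u) (V (H after u))
  opponent-move-in {u} (u∈ , own) =
    closed-between G c′ (after-largest G rel own c′ (after-relevant H relW own) u∉)
      (p─q⊆p _ _)
    where
    c′ = closed-trans G c (after-closed H relW own)
    u∉ : u ∉ V (H after u)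
    u∉ u∈′ = ∈─⇒∉ u∈′ (x∈p∪q⁺ (inj₁ (∈-cut H u∈)))

  opponent-move-out : ∀ {u} → Owned G (opponent J) u → u ∉ W → Closed J (G after u) W
  opponent-move-out (u∈ , own) u∉ =
    closed-between G c (after-largest G rel own c relW u∉) (p─q⊆p _ _)

  module _ {u : Fin n} (o : Owned H J u) where

    private
      own² : owner G u ≡ opponent (opponent J)
      own² = proj₂ (owned-involutive H o)

      G′ = G ∖ cut G u
      H′ = H ∖ cut H u

      cut-⊆ : cut H u ⊆ cut G u
      cut-⊆ z∈ with z∈W , p ← cut⁻ H J (proj₂ o) z∈ =
        cut⁺ G J (proj₂ o) (included c z∈W) (toward-↾⁻ G (included c) J p)

      -- `J` removes along paths that start at `u` in `W` and hence stay in `W`; thus both cuts are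
      -- the same set.
      cut-⊇ : ∀ {z} → z ∈ cut G u → z ∈ cut H u
      cut-⊇ z∈ with z∈W , p ← toward-↾⁺ G c (proj₁ o) (proj₂ (cut⁻ G J (proj₂ o) z∈)) =
        cut⁺ H J (proj₂ o) z∈W p

      c′ : Closed J G′ (V H′)
      c′ = closed
        (λ z∈ → x∈p∧x∉q⇒x∈p─q (included c (p─q⊆p _ _ z∈)) (∈─⇒∉ z∈ ∘ cut-⊇))
        (λ a x∈ → x∈p∧x∉q⇒x∈p─q
          (stays c (step-↾⁻ G (p─q⊆p _ _) J a) (p─q⊆p _ _ x∈))
          (∈─⇒∉ (step-target G′ J a) ∘ cut-⊆))

    -- The vertices forced after a move of `J` on `H` are forced for `J`, and this lifts from `H′`
    -- to `G′` because `V H′` is closed in `G′`.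
    Rmv-⊆ : Rmv H u ⊆ Rmv G u
    Rmv-⊆ z∈ = x∈p∪q⁺ (Sum.map cut-⊆
      (λ z∈F → Forc⁺ G′ J (forced-↾⁻ G′ c′
        (subst (λ K → ForcedFor H′ K _) (opponent-involutive J) (Forc-cut H relW own² z∈F))))
      (x∈p∪q⁻ (cut H u) _ z∈))

    Rmv-⊇ : ∀ {z} → z ∈ W → z ∈ Rmv G u → z ∈ Rmv H u
    Rmv-⊇ {z} z∈W z∈ with z ∈? cut H u | x∈p∪q⁻ (cut G u) _ z∈
    ... | yes z∈cut | _           = x∈p∪q⁺ (inj₁ z∈cut)
    ... | no  _     | inj₁ z∈cut = x∈p∪q⁺ (inj₁ (cut-⊇ z∈cut))
    ... | no  z∉cut | inj₂ z∈F
      with K , f ← Forc⁻ G′ z∈F =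
      x∈p∪q⁺ (inj₂ (Forc⁺ H′ K
        (forced-↾⁺ G′ (included c′) K (x∈p∧x∉q⇒x∈p─q z∈W z∉cut) f)))

    -- By the two inclusions, both moves remove the same part of `W`.
    own-move : Closed J (G after u) (V (H after u))
    own-move = closed
      (λ z∈ → x∈p∧x∉q⇒x∈p─q (included c (p─q⊆p _ _ z∈))
        (∈─⇒∉ z∈ ∘ Rmv-⊇ (p─q⊆p _ _ z∈)))
      (λ a x∈ → x∈p∧x∉q⇒x∈p─q
        (stays c (step-↾⁻ G (p─q⊆p _ _) J a) (p─q⊆p _ _ x∈))
        (∈─⇒∉ (step-target (G after _) J a) ∘ Rmv-⊆))

-- The scores of the two players add up to the number of vertices.

relevant-unowned : (G : Graph n) → Relevant G → ∀ K → (∀ {u} → ¬ Owned G K u) → ∣ V G ∣ ≡ 0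
relevant-unowned {n} G rel K none = trans (cong ∣_∣ (Empty-unique empty)) (∣⊥∣≡0 n)
  where
  empty : Empty (V G)
  -- If every vertex belongs to the opponent of `K`, then each one is forced for that opponent.
  empty (x , x∈) = relevant-elim G rel (opponent K) (x∈ , λ {y} p →
    [ (λ eq → contradiction (toward-target G (opponent K) x∈ p , eq) none) , id ]′
      (own-or-opponent K (owner G y)))

move-relevant : (G : Graph n) → Relevant G → ∀ {K u} → Owned G K u → Relevant (G after u)
move-relevant G rel o = after-relevant G rel (proj₂ (owned-involutive G o))

-- The player `opponent K` starts in both scores. A best first move for `s₁ J` is a candidate for
-- the minimum defining `s₂ K`, giving the upper bound; a minimizing move for `s₂ K` is a candidate
-- for the maximum defining `s₁ J`, giving the lower one.
total : ∀ k K (G : Graph n) → ∣ V G ∣ < k → Relevant G →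
        s₁ (opponent K) G + s₂ K G ≡ ∣ V G ∣
total (suc k) K G G<k rel = ≤-antisym upper lower
  where
  J = opponent K

  split : ∀ {u} → Owned G J u →
          ∣ Rmv G u ∣ + s₂ J (G after u) + s₁ K (G after u) ≡ ∣ V G ∣
  split {u} o = begin-equality
    ∣ Rmv G u ∣ + s₂ J G′ + s₁ K G′   ≡⟨ +-assoc ∣ Rmv G u ∣ _ _ ⟩
    ∣ Rmv G u ∣ + (s₂ J G′ + s₁ K G′) ≡⟨ cong (∣ Rmv G u ∣ +_) (+-comm (s₂ J G′) _) ⟩
    ∣ Rmv G u ∣ + (s₁ K G′ + s₂ J G′) ≡⟨ cong (∣ Rmv G u ∣ +_) total′ ⟩
    ∣ Rmv G u ∣ + ∣ V G′ ∣            ≡⟨ ∣Rmv∣+∣after∣≡∣V∣ G u ⟩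
    ∣ V G ∣                            ∎
    where
    open ≤-Reasoning
    G′ = G after u
    total′ : s₁ K G′ + s₂ J G′ ≡ ∣ V G′ ∣
    total′ = subst (λ I → s₁ I G′ + s₂ J G′ ≡ ∣ V G′ ∣) (opponent-involutive K)
      (total k J G′ (<-≤-trans (after-< G (proj₁ o)) (s≤s⁻¹ G<k)) (move-relevant G rel o))

  upper : s₁ J G + s₂ K G ≤ ∣ V G ∣
  upper with s₁-attained G J | s₂-attained G K
  ... | inj₂ (u , o , eq) | _ rewrite eq =
    ≤-trans (+-monoʳ-≤ _ (s₂-≤ G o)) (≤-reflexive (split o))
  ... | inj₁ (_ , eq)   | inj₁ (_ , eq′) rewrite eq | eq′ = z≤n
  ... | inj₁ (none , _) | inj₂ (_ , o , _) = contradiction o none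

  lower : ∣ V G ∣ ≤ s₁ J G + s₂ K G
  lower with s₂-attained G K
  ... | inj₁ (none , _) = subst (_≤ s₁ J G + s₂ K G) (sym (relevant-unowned G rel J none)) z≤n
  ... | inj₂ (u , o , eq) rewrite eq =
    ≤-trans (≤-reflexive (sym (split o))) (+-monoˡ-≤ _ (s₁-≥ G o))

-- Simultaneous induction for monotonicity and the advantage of starting.

monotone₁ : ∀ k J (G : Graph n) {W} → ∣ V G ∣ < k → Closed J G W → Relevant G →
            Relevant (G ↾ W) → s₁ J (G ↾ W) ≤ s₁ J G
monotone₂ : ∀ k J (G : Graph n) {W} → ∣ V G ∣ < k → Closed J G W → Relevant G →
            Relevant (G ↾ W) → s₂ J (G ↾ W) ≤ s₂ J G
advantage : ∀ k K (G : Graph n) → ∣ V G ∣ < k → Relevant G → s₂ K G ≤ s₁ K G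

monotone₁ (suc k) J G {W} G<k c rel relW with s₁-attained (G ↾ W) J
... | inj₁ (_ , eq)      rewrite eq = z≤n
... | inj₂ (u , o , eq) rewrite eq = ≤-trans
  (+-mono-≤ (p⊆q⇒∣p∣≤∣q∣ (Rmv-⊆ G c rel relW o))
    (monotone₂ k J (G after u) (<-≤-trans (after-< G (proj₁ o′)) (s≤s⁻¹ G<k))
      (own-move G c rel relW o) (move-relevant G rel o′) (move-relevant (G ↾ W) relW o)))
  (s₁-≥ G o′)
  where
  o′ : Owned G J u
  o′ = included c (proj₁ o) , proj₂ o

monotone₂ (suc k) J G {W} G<k c rel relW with s₂-attained G J | s₂-attained (G ↾ W) J
... | inj₁ _ | inj₁ (_ , eq) rewrite eq = z≤n
... | inj₁ (none , _) | inj₂ (_ , (u∈ , own) , _) =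
  contradiction (included c u∈ , own) none
... | inj₂ (u , o , eq) | _ rewrite eq with u ∈? W
-- The opponent's best reply in `G` is also available in `G ↾ W`, where it bounds the minimum from
-- above.
...   | yes u∈ = ≤-trans (s₂-≤ (G ↾ W) o′)
  (monotone₁ k J (G after u) G′<k (opponent-move-in G c rel relW o′)
    (move-relevant G rel o) (move-relevant (G ↾ W) relW o′))
  where
  G′<k = <-≤-trans (after-< G (proj₁ o)) (s≤s⁻¹ G<k)
  o′ : Owned (G ↾ W) (opponent J) u
  o′ = u∈ , proj₂ o
-- `W` survives the move, and the bound passes through `s₁ J (G ↾ W)`. As `W` lies in the strictly
-- smaller `G after u`, `advantage` applies at `k`.
...   | no u∉ = ≤-trans
  (advantage k J (G ↾ W) (≤-<-trans (p⊆q⇒∣p∣≤∣q∣ (included c′)) G′<k) relW)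
  (monotone₁ k J (G after u) G′<k c′ (move-relevant G rel o) relW)
  where
  G′<k = <-≤-trans (after-< G (proj₁ o)) (s≤s⁻¹ G<k)
  c′ = opponent-move-out G c rel relW o u∉

-- `monotone₁` is called below at the same `k`; the recursion terminates because the monotonicity
-- proofs only call at a smaller bound.
advantage k K G G<k rel with s₁-attained G K
... | inj₁ (none , _) = begin
    s₂ K G                        ≤⟨ m≤n+m (s₂ K G) (s₁ (opponent K) G) ⟩
    s₁ (opponent K) G + s₂ K G    ≡⟨ total k K G G<k rel ⟩
    ∣ V G ∣                       ≡⟨ relevant-unowned G rel K none ⟩
    0                             ≤⟨ z≤n ⟩
    s₁ K G                        ∎
  where open ≤-Reasoning
-- Adding `s₁ J G` to both sides lets `total` turn scores into vertex counts, for `G` and for `G′`.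
-- The one real loss before the bound by `s₁ K G` is replacing `s₁ J G′` by `s₁ J G`.
... | inj₂ (u , o , _) = +-cancelˡ-≤ (s₁ J G) _ _ (begin
    s₁ J G + s₂ K G                   ≡⟨ total k K G G<k rel ⟩
    ∣ V G ∣                           ≡⟨ ∣Rmv∣+∣after∣≡∣V∣ G u ⟨
    ∣ Rmv G u ∣ + ∣ V G′ ∣            ≡⟨ cong (∣ Rmv G u ∣ +_) (total k K G′ G′<k rel′) ⟨
    ∣ Rmv G u ∣ + (s₁ J G′ + s₂ K G′) ≤⟨ +-monoʳ-≤ ∣ Rmv G u ∣ (+-monoˡ-≤ (s₂ K G′) mono) ⟩
    ∣ Rmv G u ∣ + (s₁ J G + s₂ K G′)  ≡⟨ x∙yz≈y∙xz +-commutativeSemigroup ∣ Rmv G u ∣ (s₁ J G) (s₂ K G′) ⟩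
    s₁ J G + (∣ Rmv G u ∣ + s₂ K G′)  ≤⟨ +-monoʳ-≤ (s₁ J G) (s₁-≥ G o) ⟩
    s₁ J G + s₁ K G                   ∎)
  where
  open ≤-Reasoning
  J = opponent K
  G′ = G after u
  rel′ = move-relevant G rel o
  G′<k = <-trans (after-< G (proj₁ o)) G<k
  mono : s₁ J G′ ≤ s₁ J G
  mono = monotone₁ k J G G<k (after-closed G rel (proj₂ (owned-involutive G o))) rel rel′

corollary12 : ∀ {n : ℕ} (G : Graph n) → Relevant G → (K : Player) → s₁ K G ≥ s₂ K G
corollary12 G rel K = advantage (suc ∣ V G ∣) K G ≤-refl rel
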